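{- For every integer $n\ge 1$ and every integer $k$ with $0\le k\le 2^{n}-2$, $$B_{k+1}(t)B_{2^{n}-k}(t)-B_{k}(t)B_{2^{n}-k-1}(t)=t^{n}.$$
   Context: The Stern polynomials $B_n(t)\in\mathbb{Z}[t]$, $n\ge 0$, are defined by $B_0(t)=0$, $B_1(t)=1$, $B_{2n}(t)=tB_n(t)$ and $B_{2n+1}(t)=B_n(t)+B_{n+1}(t)$ for $n\ge 1$. -}

module Defs where

open import Data.Integer as ℤ using (ℤ; 0ℤ; 1ℤ)
open import Data.List using (List; []; _∷_; map)
open import Data.Nat using (ℕ; zero; suc; _+_; _*_; _<_; z≤n; s≤s; ⌊_/2⌋; ⌈_/2⌉; parity; NonZero)
open import Data.Nat.Induction using (Acc; acc; <-wellFounded)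
open import Data.Nat.Properties using (+-identityʳ; +-comm; *-monoʳ-≤; ⌊n/2⌋<n; ⌈n/2⌉<n; n≡⌊n+n/2⌋; n≡⌈n+n/2⌉)
open import Data.Parity using (Parity; 0ℙ; 1ℙ)
open import Data.Parity.Properties using (*-homo-*; suc-homo-⁻¹; ⁻¹-injective)
open import Relation.Binary.PropositionalEquality using (_≡_; refl; sym; trans; cong; cong₂)

infix  4 _≈ₚ_
infixl 6 _+ₚ_ _-ₚ_
infixl 7 _*ₚ_
infix  8 -ₚ_
infixr 8 _^ₚ_

-- Integer polynomials as coefficient lists, constant term first.  Trailing
-- zeros are allowed, so equality of polynomials is _≈ₚ_ rather than _≡_.

Poly : Set
Poly = List ℤ

coeff : Poly → ℕ → ℤ
coeff []      _       = 0ℤ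
coeff (a ∷ p) zero    = a
coeff (a ∷ p) (suc i) = coeff p i

_≈ₚ_ : Poly → Poly → Set
p ≈ₚ q = ∀ i → coeff p i ≡ coeff q i

0ₚ 1ₚ t : Poly
0ₚ = []
1ₚ = 1ℤ ∷ []
t  = 0ℤ ∷ 1ℤ ∷ []

_+ₚ_ : Poly → Poly → Poly
[]      +ₚ q       = q
(a ∷ p) +ₚ []      = a ∷ p
(a ∷ p) +ₚ (b ∷ q) = (a ℤ.+ b) ∷ (p +ₚ q)

-ₚ_ : Poly → Poly
-ₚ p = map (ℤ.-_) p

_-ₚ_ : Poly → Poly → Poly
p -ₚ q = p +ₚ (-ₚ q)

-- (a + t p) q = a q + t (p q)
_*ₚ_ : Poly → Poly → Poly
[]      *ₚ q = []
(a ∷ p) *ₚ q = map (a ℤ.*_) q +ₚ (0ℤ ∷ (p *ₚ q))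

_^ₚ_ : Poly → ℕ → Poly
p ^ₚ zero  = 1ₚ
p ^ₚ suc n = p *ₚ (p ^ₚ n)

-- For m ≥ 2, B m is obtained from b = B ⌊ m /2⌋ and b′ = B ⌈ m /2⌉; for
-- m = 2n these are both B n, and for m = 2n + 1 they are B n and B (n + 1).
-- The defining recurrences are B-even and B-odd below.

B-step : Parity → Poly → Poly → Poly
B-step 0ℙ b b′ = t *ₚ b
B-step 1ℙ b b′ = b +ₚ b′

B-acc : ∀ m → Acc _<_ m → Poly
B-acc 0 _ = 0ₚ
B-acc 1 _ = 1ₚ
B-acc m@(suc (suc k)) (acc rs) =
  B-step (parity m) (B-acc ⌊ m /2⌋ (rs (⌊n/2⌋<n (suc k))))
                    (B-acc ⌈ m /2⌉ (rs (⌈n/2⌉<n k)))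

B : ℕ → Poly
B m = B-acc m (<-wellFounded m)

B-acc-irrelevant : ∀ m (p q : Acc _<_ m) → B-acc m p ≡ B-acc m q
B-acc-irrelevant 0 _ _ = refl
B-acc-irrelevant 1 _ _ = refl
B-acc-irrelevant m@(suc (suc k)) (acc rs) (acc rs′) =
  cong₂ (B-step (parity m)) (B-acc-irrelevant ⌊ m /2⌋ _ _)
                            (B-acc-irrelevant ⌈ m /2⌉ _ _)

B-unfold : ∀ k → let m = suc (suc k) in
           B m ≡ B-step (parity m) (B ⌊ m /2⌋) (B ⌈ m /2⌉)
B-unfold k =
  cong₂ (B-step (parity k)) (B-acc-irrelevant (suc ⌊ k /2⌋) _ _)
                            (B-acc-irrelevant (suc ⌊ suc k /2⌋) _ _)

private
  double : ∀ n → 2 * n ≡ n + n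
  double n = cong (n +_) (+-identityʳ n)

  parity-even : ∀ n → parity (2 * n) ≡ 0ℙ
  parity-even n = *-homo-* 2 n

  parity-odd : ∀ n → parity (suc (2 * n)) ≡ 1ℙ
  parity-odd n = ⁻¹-injective (trans (suc-homo-⁻¹ (2 * n)) (parity-even n))

  ⌊2n/2⌋ : ∀ n → ⌊ 2 * n /2⌋ ≡ n
  ⌊2n/2⌋ n = trans (cong ⌊_/2⌋ (double n)) (sym (n≡⌊n+n/2⌋ n))

  ⌊1+2n/2⌋ : ∀ n → ⌊ suc (2 * n) /2⌋ ≡ n
  ⌊1+2n/2⌋ n = trans (cong ⌈_/2⌉ (double n)) (sym (n≡⌈n+n/2⌉ n))

  B-unfold′ : ∀ m {π a b} → 1 < m → parity m ≡ π → ⌊ m /2⌋ ≡ a → ⌈ m /2⌉ ≡ b →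
              B m ≡ B-step π (B a) (B b)
  B-unfold′ (suc (suc k)) _ refl refl refl = B-unfold k
  B-unfold′ 1 (s≤s ()) _ _ _

B-zero : B 0 ≡ 0ₚ
B-zero = refl

B-one : B 1 ≡ 1ₚ
B-one = refl

B-even : ∀ n .{{_ : NonZero n}} → B (2 * n) ≡ t *ₚ B n
B-even n@(suc _) = B-unfold′ (2 * n) 1<2n (parity-even n) (⌊2n/2⌋ n) (⌊1+2n/2⌋ n)
  where
  1<2n : 1 < 2 * n
  1<2n = *-monoʳ-≤ 2 (s≤s z≤n)

B-odd : ∀ n .{{_ : NonZero n}} → B (2 * n + 1) ≡ B n +ₚ B (n + 1)
B-odd n@(suc _) rewrite +-comm (2 * n) 1 | +-comm n 1 =
  B-unfold′ (suc (2 * n)) (s≤s (s≤s z≤n)) (parity-odd n) (⌊1+2n/2⌋ n) (cong suc (⌊2n/2⌋ n))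

{-# OPTIONS --safe #-}
module Submission where

open import Defs
open import Data.Empty using (⊥-elim)
open import Data.Integer as ℤ using (ℤ; 0ℤ)
import Data.Integer.Properties as ℤ
open import Data.Integer.Tactic.RingSolver using (solve-∀)
open import Data.List using ([]; _∷_; map)
open import Data.Nat using (ℕ; zero; suc; _+_; _*_; _∸_; _^_; _≤_; _<_; s≤s)
import Data.Nat.Properties as ℕ
import Data.Nat.Tactic.RingSolver as ℕ-Solver
open import Data.Product using (∃; _,_)
open import Data.Sum using (_⊎_; inj₁; inj₂)
open import Function using (_∘_)
open import Relation.Binary.PropositionalEquality

-- With the symmetric indexing k + j + 1 = 2ⁿ the claim reads
-- B (k+1) B (j+1) − B k B j = tⁿ.  Exactly one of k and j is even; halving both,
-- the recurrences turn the left-hand side into t times the same expression for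
-- n − 1, the two mixed terms cancelling.  This uses only that multiplication is
-- bilinear and commutes with multiplication by t, which is checked on the
-- coefficient sequences.

-- As coefficient functions, polynomials that agree under `≈ₚ` agree pointwise, whatever trailing
-- zeros their lists carry.
Seq : Set
Seq = ℕ → ℤ

infix  5 _≗ₛ_
infixl 6 _⊕_ _⊖_
infixl 7 _⋆_

_≗ₛ_ : Seq → Seq → Set
f ≗ₛ g = ∀ i → f i ≡ g i

-- `⋆` is the Cauchy product, peeling off the constant term of the left factor just as `*ₚ` does.
_⊕_ _⊖_ _⋆_ : Seq → Seq → Seq
(f ⊕ g) i = f i ℤ.+ g i
(f ⊖ g) i = f i ℤ.- g i
(f ⋆ g) zero    = f 0 ℤ.* g 0
(f ⋆ g) (suc i) = f 0 ℤ.* g (suc i) ℤ.+ ((f ∘ suc) ⋆ g) i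

-- Multiplication by `t`.
shift : Seq → Seq
shift f zero    = 0ℤ
shift f (suc i) = f i

shift-cong : ∀ {f g} → f ≗ₛ g → shift f ≗ₛ shift g
shift-cong e zero    = refl
shift-cong e (suc i) = e i

⋆-cong : ∀ {f f′ g g′} → f ≗ₛ f′ → g ≗ₛ g′ → f ⋆ g ≗ₛ f′ ⋆ g′
⋆-cong d e zero    = cong₂ ℤ._*_ (d 0) (e 0)
⋆-cong d e (suc i) =
  cong₂ ℤ._+_ (cong₂ ℤ._*_ (d 0) (e (suc i))) (⋆-cong (d ∘ suc) e i)

⋆-zeroˡ : ∀ g → (λ _ → 0ℤ) ⋆ g ≗ₛ λ _ → 0ℤ
⋆-zeroˡ g zero    = refl
⋆-zeroˡ g (suc i) = trans (ℤ.+-identityˡ _) (⋆-zeroˡ g i)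

⋆-distribʳ-⊕ : ∀ f f′ g → (f ⊕ f′) ⋆ g ≗ₛ f ⋆ g ⊕ f′ ⋆ g
⋆-distribʳ-⊕ f f′ g zero    = ℤ.*-distribʳ-+ (g 0) (f 0) (f′ 0)
⋆-distribʳ-⊕ f f′ g (suc i) =
  trans (cong (ℤ._+_ ((f 0 ℤ.+ f′ 0) ℤ.* g (suc i))) (⋆-distribʳ-⊕ (f ∘ suc) (f′ ∘ suc) g i))
    (rearrange (f 0) (f′ 0) (g (suc i)) (((f ∘ suc) ⋆ g) i) (((f′ ∘ suc) ⋆ g) i))
  where
  rearrange : ∀ a b c x y →
    (a ℤ.+ b) ℤ.* c ℤ.+ (x ℤ.+ y) ≡ (a ℤ.* c ℤ.+ x) ℤ.+ (b ℤ.* c ℤ.+ y)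
  rearrange = solve-∀

⋆-distribˡ-⊕ : ∀ f g g′ → f ⋆ (g ⊕ g′) ≗ₛ f ⋆ g ⊕ f ⋆ g′
⋆-distribˡ-⊕ f g g′ zero    = ℤ.*-distribˡ-+ (f 0) (g 0) (g′ 0)
⋆-distribˡ-⊕ f g g′ (suc i) =
  trans (cong (ℤ._+_ (f 0 ℤ.* (g (suc i) ℤ.+ g′ (suc i)))) (⋆-distribˡ-⊕ (f ∘ suc) g g′ i))
    (rearrange (f 0) (g (suc i)) (g′ (suc i)) (((f ∘ suc) ⋆ g) i) (((f ∘ suc) ⋆ g′) i))
  where
  rearrange : ∀ a b c x y →
    a ℤ.* (b ℤ.+ c) ℤ.+ (x ℤ.+ y) ≡ (a ℤ.* b ℤ.+ x) ℤ.+ (a ℤ.* c ℤ.+ y)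
  rearrange = solve-∀

⋆-shiftˡ : ∀ f g → shift f ⋆ g ≗ₛ shift (f ⋆ g)
⋆-shiftˡ f g zero    = refl
⋆-shiftˡ f g (suc i) = ℤ.+-identityˡ _

⋆-shiftʳ : ∀ f g → f ⋆ shift g ≗ₛ shift (f ⋆ g)
⋆-shiftʳ f g zero          = ℤ.*-zeroʳ (f 0)
-- `⋆` recurses on its left factor, so the leading 0 of `shift g` only appears in the last summand;
-- here that summand is `f 1` times 0.
⋆-shiftʳ f g (suc zero)    =
  trans (cong (ℤ._+_ (f 0 ℤ.* g 0)) (ℤ.*-zeroʳ (f 1))) (ℤ.+-identityʳ _)
⋆-shiftʳ f g (suc (suc i)) = cong (ℤ._+_ (f 0 ℤ.* g (suc i))) (⋆-shiftʳ _ g (suc i))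

⊖-shift : ∀ f g → shift f ⊖ shift g ≗ₛ shift (f ⊖ g)
⊖-shift f g zero    = refl
⊖-shift f g (suc i) = refl

coeff-+ : ∀ p q → coeff (p +ₚ q) ≗ₛ coeff p ⊕ coeff q
coeff-+ []      q       i       = sym (ℤ.+-identityˡ _)
coeff-+ (a ∷ p) []      i       = sym (ℤ.+-identityʳ _)
coeff-+ (a ∷ p) (b ∷ q) zero    = refl
coeff-+ (a ∷ p) (b ∷ q) (suc i) = coeff-+ p q i

-- Beyond the end of the list both coefficients default to 0, hence the condition that `h` fixes 0.
coeff-map : ∀ (h : ℤ → ℤ) → h 0ℤ ≡ 0ℤ → ∀ p i → coeff (map h p) i ≡ h (coeff p i)
coeff-map h h0 []      i       = sym h0
coeff-map h h0 (a ∷ p) zero    = refl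
coeff-map h h0 (a ∷ p) (suc i) = coeff-map h h0 p i

coeff-- : ∀ p q → coeff (p -ₚ q) ≗ₛ coeff p ⊖ coeff q
coeff-- p q i =
  trans (coeff-+ p (-ₚ q) i) (cong (ℤ._+_ (coeff p i)) (coeff-map (ℤ.-_) refl q i))

coeff-* : ∀ p q → coeff (p *ₚ q) ≗ₛ coeff p ⋆ coeff q
coeff-* []      q i = sym (⋆-zeroˡ (coeff q) i)
coeff-* (a ∷ p) q i = trans (coeff-+ (map (a ℤ.*_) q) _ i) (split i)
  where
  split : coeff (map (a ℤ.*_) q) ⊕ coeff (0ℤ ∷ (p *ₚ q)) ≗ₛ coeff (a ∷ p) ⋆ coeff q
  split zero    = trans (ℤ.+-identityʳ _) (coeff-map (a ℤ.*_) (ℤ.*-zeroʳ a) q 0)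
  split (suc i) = cong₂ ℤ._+_ (coeff-map (a ℤ.*_) (ℤ.*-zeroʳ a) q (suc i)) (coeff-* p q i)

coeff-t* : ∀ p → coeff (t *ₚ p) ≗ₛ shift (coeff p)
coeff-t* p zero          = coeff-* t p 0
coeff-t* p (suc zero)    =
  trans (coeff-* t p 1) (trans (ℤ.+-identityˡ _) (ℤ.*-identityˡ _))
coeff-t* p (suc (suc i)) =
  trans (coeff-* t p (suc (suc i)))
    (trans (ℤ.+-identityˡ _)
      (trans (cong₂ ℤ._+_ (ℤ.*-identityˡ (coeff p (suc i))) (⋆-zeroˡ (coeff p) i)) (ℤ.+-identityʳ _)))

b : ℕ → Seq
b m = coeff (B m)

-- Together with `b-odd`, this extends the recurrences to `m = 0`, where they hold because `B 0` is
-- zero; halving an index may lead there.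
b-even : ∀ m → b (2 * m) ≗ₛ shift (b m)
b-even zero        zero    = refl
b-even zero        (suc i) = refl
b-even m@(suc _)   i       = trans (cong (λ p → coeff p i) (B-even m)) (coeff-t* (B m) i)

b-odd : ∀ m → b (suc (2 * m)) ≗ₛ b m ⊕ b (suc m)
b-odd zero      i = sym (ℤ.+-identityˡ _)
b-odd m@(suc _) i = trans (cong (λ p → coeff p i) B-odd′) (coeff-+ (B m) (B (suc m)) i)
  where
  B-odd′ : B (suc (2 * m)) ≡ B m +ₚ B (suc m)
  B-odd′ = trans (cong B (ℕ.+-comm 1 (2 * m)))
                 (trans (B-odd m) (cong (λ n → B m +ₚ B n) (ℕ.+-comm m 1)))

b-even-suc : ∀ m → b (suc (suc (2 * m))) ≗ₛ shift (b (suc m))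
b-even-suc m i = trans (cong (λ n → b n i) (sym (ℕ.*-suc 2 m))) (b-even (suc m) i)

-- The mixed product `f ⋆ g′` occurs in both expanded terms and cancels. The four sequences stand
-- for the Stern polynomials at `k`, `k + 1`, `j`, `j + 1`.
crossˡ : ∀ f f′ g g′ → (f ⊕ f′) ⋆ shift g′ ⊖ shift f ⋆ (g ⊕ g′) ≗ₛ shift (f′ ⋆ g′ ⊖ f ⋆ g)
crossˡ f f′ g g′ i =
  trans (cong₂ ℤ._-_ (trans (⋆-shiftʳ (f ⊕ f′) g′ i) (shift-cong (⋆-distribʳ-⊕ f f′ g′) i))
                     (trans (⋆-shiftˡ f (g ⊕ g′) i) (shift-cong (⋆-distribˡ-⊕ f g g′) i)))
    (trans (⊖-shift (f ⋆ g′ ⊕ f′ ⋆ g′) (f ⋆ g ⊕ f ⋆ g′) i)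
      (shift-cong (λ j → cancel ((f ⋆ g′) j) ((f′ ⋆ g′) j) ((f ⋆ g) j)) i))
  where
  cancel : ∀ x y z → (x ℤ.+ y) ℤ.- (z ℤ.+ x) ≡ y ℤ.- z
  cancel = solve-∀

-- Mirror image of `crossˡ`, with `f′ ⋆ g` cancelling; a direct proof avoids commutativity of `⋆`.
crossʳ : ∀ f f′ g g′ → shift f′ ⋆ (g ⊕ g′) ⊖ (f ⊕ f′) ⋆ shift g ≗ₛ shift (f′ ⋆ g′ ⊖ f ⋆ g)
crossʳ f f′ g g′ i =
  trans (cong₂ ℤ._-_ (trans (⋆-shiftˡ f′ (g ⊕ g′) i) (shift-cong (⋆-distribˡ-⊕ f′ g g′) i))
                     (trans (⋆-shiftʳ (f ⊕ f′) g i) (shift-cong (⋆-distribʳ-⊕ f f′ g) i)))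
    (trans (⊖-shift (f′ ⋆ g ⊕ f′ ⋆ g′) (f ⋆ g ⊕ f′ ⋆ g) i)
      (shift-cong (λ j → cancel ((f′ ⋆ g) j) ((f′ ⋆ g′) j) ((f ⋆ g) j)) i))
  where
  cancel : ∀ x y z → (x ℤ.+ y) ℤ.- (z ℤ.+ x) ≡ y ℤ.- z
  cancel = solve-∀

W : ℕ → ℕ → Seq
W k j = b (suc k) ⋆ b (suc j) ⊖ b k ⋆ b j

W-even-odd : ∀ k j → W (2 * k) (suc (2 * j)) ≗ₛ shift (W k j)
W-even-odd k j i =
  trans (cong₂ ℤ._-_ (⋆-cong (b-odd k) (b-even-suc j) i) (⋆-cong (b-even k) (b-odd j) i))
        (crossˡ (b k) (b (suc k)) (b j) (b (suc j)) i)

W-odd-even : ∀ k j → W (suc (2 * k)) (2 * j) ≗ₛ shift (W k j)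
W-odd-even k j i =
  trans (cong₂ ℤ._-_ (⋆-cong (b-even-suc k) (b-odd j) i) (⋆-cong (b-odd k) (b-even j) i))
        (crossʳ (b k) (b (suc k)) (b j) (b (suc j)) i)

halve : ∀ n → ∃ λ m → n ≡ 2 * m ⊎ n ≡ suc (2 * m)
halve zero    = 0 , inj₁ refl
halve (suc n) with halve n
... | m , inj₁ e = m , inj₂ (cong suc e)
... | m , inj₂ e = suc m , inj₁ (trans (cong suc e) (sym (ℕ.*-suc 2 m)))

-- Induction on `n` from 0, where the index equation forces `k = j = 0` and the claim is
-- `1 * 1 - 0 * 0 = 1`.
W-pow : ∀ n k j → suc (k + j) ≡ 2 ^ n → W k j ≗ₛ coeff (t ^ₚ n)
W-pow zero zero zero _ zero          = refl
W-pow zero zero zero _ (suc zero)    = refl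
W-pow zero zero zero _ (suc (suc i)) = cong₂ ℤ._-_ (1⋆ i) (0⋆ i)
  where
  1⋆ : ∀ i → (b 1 ⋆ b 1) (suc (suc i)) ≡ 0ℤ
  1⋆ i = sym (coeff-* 1ₚ 1ₚ (suc (suc i)))
  0⋆ : ∀ i → (b 0 ⋆ b 0) (suc (suc i)) ≡ 0ℤ
  0⋆ i = ⋆-zeroˡ (b 0) (suc (suc i))
W-pow (suc n) k j e i with halve k | halve j
... | k′ , inj₁ refl | j′ , inj₁ refl =
  -- Equal parities, here and in the next case, would make `k + j + 1` odd, yet it equals
  -- `2 * 2 ^ n`.
  ⊥-elim (ℕ.even≢odd (2 ^ n) (k′ + j′)
    (sym (trans (cong suc (ℕ.*-distribˡ-+ 2 k′ j′)) e)))
... | k′ , inj₂ refl | j′ , inj₂ refl =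
  ⊥-elim (ℕ.even≢odd (2 ^ n) (suc (k′ + j′)) (sym (trans (regroup k′ j′) e)))
  where
  regroup : ∀ k j → suc (2 * suc (k + j)) ≡ suc (suc (2 * k) + suc (2 * j))
  regroup = ℕ-Solver.solve-∀
... | k′ , inj₁ refl | j′ , inj₂ refl =
  trans (W-even-odd k′ j′ i)
    -- The index equation is `2 * (k′ + j′ + 1) = 2 * 2 ^ n`; cancelling 2 gives the one for `n`.
    (trans (shift-cong (W-pow n k′ j′ (ℕ.*-cancelˡ-≡ _ _ 2 (trans (regroup k′ j′) e))) i)
      (sym (coeff-t* (t ^ₚ n) i)))
  where
  regroup : ∀ k j → 2 * suc (k + j) ≡ suc (2 * k + suc (2 * j))
  regroup = ℕ-Solver.solve-∀
... | k′ , inj₂ refl | j′ , inj₁ refl =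
  trans (W-odd-even k′ j′ i)
    (trans (shift-cong (W-pow n k′ j′ (ℕ.*-cancelˡ-≡ _ _ 2 (trans (regroup k′ j′) e))) i)
      (sym (coeff-t* (t ^ₚ n) i)))
  where
  regroup : ∀ k j → 2 * suc (k + j) ≡ suc (suc (2 * k) + 2 * j)
  regroup = ℕ-Solver.solve-∀

-- This survives truncation at `m = 1`, where the bound reads `k ≤ 0`.
k≤m∸2⇒k<m : ∀ {k} m → 0 < m → k ≤ m ∸ 2 → k < m
k≤m∸2⇒k<m (suc m) _ k≤ = ℕ.≤-<-trans k≤ (s≤s (ℕ.m∸n≤m m 1))

theorem2p5 : ∀ (n k : ℕ) → 1 ≤ n → k ≤ 2 ^ n ∸ 2 →
    B (k + 1) *ₚ B (2 ^ n ∸ k) -ₚ B k *ₚ B (2 ^ n ∸ k ∸ 1) ≈ₚ t ^ₚ n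
theorem2p5 n k _ k≤ i with 2 ^ n ∸ k in eq
... | zero  = ⊥-elim (ℕ.m>n⇒m∸n≢0 (k≤m∸2⇒k<m (2 ^ n) (ℕ.m^n>0 2 n) k≤) eq)
-- With `2 ^ n ∸ k` matched as `suc j`, the index `2 ^ n ∸ k ∸ 1` reduces to `j`, which gives the
-- symmetric form.
... | suc j rewrite ℕ.+-comm k 1 =
  trans (coeff-- (B (suc k) *ₚ B (suc j)) (B k *ₚ B j) i)
    (trans (cong₂ ℤ._-_ (coeff-* (B (suc k)) (B (suc j)) i) (coeff-* (B k) (B j) i))
      (W-pow n k j k+j+1≡2ⁿ i))
  where
  k<2ⁿ : k < 2 ^ n
  k<2ⁿ = k≤m∸2⇒k<m (2 ^ n) (ℕ.m^n>0 2 n) k≤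
  k+j+1≡2ⁿ : suc (k + j) ≡ 2 ^ n
  k+j+1≡2ⁿ = trans (sym (ℕ.+-suc k j))
               (trans (cong (k +_) (sym eq)) (ℕ.m+[n∸m]≡n (ℕ.<⇒≤ k<2ⁿ)))
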